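{- Let $\varphi$ be an $\mathsf{ELTL}_{\mathsf{FT}}$ formula, let $\sigma$ be a configuration and let $\tau\cdot\rho^\omega$ be a lasso applicable to $\sigma$ such that $\mathsf{path}(\sigma,\tau\cdot\rho^\omega)\models\varphi$ holds. Then there is a witness of $\mathsf{path}(\sigma,(\tau\cdot\rho^K)\cdot\rho^\omega)\models\varphi$ for some $K\ge0$.
   Context: **Threshold automata.** A threshold automaton is a tuple $\mathsf{TA}=(\mathcal L,\mathcal I,\Gamma,\Pi,\mathcal R,RC)$: $\mathcal L=\{1,\dots,|\mathcal L|\}$ is a finite set of local states, $\mathcal I\subseteq\mathcal L$ the initial local states; $\Gamma$ and $\Pi$ are finite sets of shared variables and parameters, ranging over $\mathbb N_0$; $RC$ is a linear integer arithmetic formula over $\Pi$, and $\mathbf P_{RC}=\{\mathbf p\in\mathbb N_0^{|\Pi|}:\mathbf p\models RC\}$ is the set of admissible parameter values; $\mathcal R$ is a finite set of rules. A rule is $r=(\mathit{from},\mathit{to},\varphi^{\le},\varphi^{>},\mathbf u)$ with $\mathit{from},\mathit{to}\in\mathcal L$, $\mathbf u\in\mathbb N_0^{|\Gamma|}$, $\varphi^{\le}$ a conjunction of lower guards $x\ge a_0+\sum_{i=1}^{|\Pi|}a_ip_i$, and $\varphi^{>}$ a conjunction of upper guards $x<a_0+\sum_{i=1}^{|\Pi|}a_ip_i$ ($x\in\Gamma$, $a_i\in\mathbb Z$, $p_i\in\Pi$). $\Phi^{\mathrm{rise}}$, $\Phi^{\mathrm{fall}}$ are the sets of lower and upper guards.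 Standing assumptions: a rule lying on a cycle (of the directed graph on $\mathcal L$ with edges $\mathit{from}\to\mathit{to}$) has $\mathbf u=\mathbf 0$; all cycles are simple, i.e. between any two locations in a cycle there is exactly one node-disjoint directed path (nodes in cycles may have self-loops). A threshold automaton is fixed. **Counter systems.** Fix a function $N:\mathbf P_{RC}\to\mathbb N_0$ (a linear combination of parameters) and $\mathbf p\in\mathbf P_{RC}$. A configuration is $\sigma=(\boldsymbol\kappa,\mathbf g,\mathbf p)$ with counters $\sigma.\boldsymbol\kappa\in\mathbb N_0^{|\mathcal L|}$, shared variable values $\sigma.\mathbf g\in\mathbb N_0^{|\Gamma|}$ and parameter values $\sigma.\mathbf p=\mathbf p$. A transition is $t=(\mathit{rule},\mathit{factor})$ with $\mathit{rule}\in\mathcal R$, $\mathit{factor}\in\mathbb N_0$; write $t.\mathit{from}=t.\mathit{rule}.\mathit{from}$, etc. $t$ is unlocked in $\sigma$ if for all $k\in\{0,\dots,t.\mathit{factor}-1\}$, $(\sigma.\boldsymbol\kappa,\sigma.\mathbf g+k\cdot t.\mathbf u,\sigma.\mathbf p)\models t.\varphi^{\le}\wedge t.\varphi^{>}$; it is applicable (enabled) in $\sigma$ if it is unlocked and $\sigma.\boldsymbol\kappa[t.\mathit{from}]\ge t.\mathit{factor}$, or $t.\mathit{factor}=0$. Then $\sigma'=t(\sigma)$ is given by $\sigma'.\mathbf g=\sigma.\mathbf g+t.\mathit{factor}\cdot t.\mathbf u$, $\sigma'.\mathbf p=\sigma.\mathbf p$, and $\sigma'.\boldsymbol\kappa$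 is obtained from $\sigma.\boldsymbol\kappa$ by subtracting $t.\mathit{factor}$ at $t.\mathit{from}$ and adding it at $t.\mathit{to}$ (no change if $t.\mathit{from}=t.\mathit{to}$). A schedule is a finite or infinite sequence $t_1,t_2,\dots$ of transitions; it is applicable to $\sigma_0$ if there are $\sigma_i=t_i(\sigma_{i-1})$ with $t_i$ applicable in $\sigma_{i-1}$ for all $i$; $\mathsf{path}(\sigma_0,\tau)$ is the sequence $\sigma_0,t_1,\sigma_1,t_2,\dots$, and for finite $\tau$, $\tau(\sigma_0)$ is its last configuration. $|\tau|$ is the length, $\tau\cdot\tau'$ concatenation. $\mathsf{Cfgs}(\sigma,\tau)\models\psi$ means $\tau'(\sigma)\models\psi$ for every prefix $\tau'$ of the finite schedule $\tau$ (including the empty prefix and $\tau$). A lasso (schedule) applicable to $\sigma$ is an infinite schedule $\tau\cdot\rho^\omega$ applicable to $\sigma$ with finite $\tau,\rho$ and $\rho^k(\tau(\sigma))=\tau(\sigma)$ for all $k\ge0$. An index $k$ cuts a schedule $\pi$ into $\pi',\pi''$ if $\pi=\pi'\cdot\pi''$ and $|\pi'|=k$. **$\mathsf{ELTL}_{\mathsf{FT}}$.** Syntax: $\psi::=\mathit{pform}\mid \mathbf G\psi\mid\mathbf F\psi\mid\psi\wedge\psi$; $\mathit{pform}::=\mathit{cform}\mid\mathit{gform}\vee\mathit{cform}$; $\mathit{cform}::=\bigvee_{\ell\in\mathit{Locs}}\boldsymbol\kappa[\ell]\ne0\mid\bigwedge_{\ell\in\mathit{Locs}}\boldsymbol\kappa[\ell]=0\mid\mathit{cform}\wedge\mathit{cform}$;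 $\mathit{gform}::=\mathit{guard}\mid\neg\mathit{gform}\mid\mathit{gform}\wedge\mathit{gform}$, with $\mathit{Locs}\subseteq\mathcal L$ and $\mathit{guard}\in\Phi^{\mathrm{rise}}\cup\Phi^{\mathrm{fall}}$. For infinite $\tau$ applicable to $\sigma$: $\mathsf{path}(\sigma,\tau)\models\varphi$ for propositional $\varphi$ iff $\sigma\models\varphi$; $\mathbf F\psi$ (resp. $\mathbf G\psi$) holds iff for some (resp. every) decomposition $\tau=\tau'\cdot\tau''$ with $\tau'$ finite, $\mathsf{path}(\tau'(\sigma),\tau'')\models\psi$; conjunction is standard. $\mathit{true}$ is a valid propositional formula, e.g. the empty conjunction. **Canonical formulas.** Propositional formulas are (finite conjunctions of) formulas derived from $\mathit{pform}$. Inductively: $p\wedge\mathbf G\,\mathit{true}$ ($p$ propositional) is canonical of rank 0; $p\wedge\mathbf F\psi_1\wedge\dots\wedge\mathbf F\psi_k\wedge\mathbf G\,\mathit{true}$ with $k\ge1$, $\psi_i$ canonical of any rank, is canonical of rank 1; $p\wedge\mathbf F\psi_1\wedge\dots\wedge\mathbf F\psi_k\wedge\mathbf G\psi_{k+1}$ with $k\ge0$, $\psi_1,\dots,\psi_k$ canonical of any rank and $\psi_{k+1}$ canonical of rank 0 or 1, is canonical of rank 2. Fix a function $\mathit{can}$ assigning to each formula an equivalent canonical formula. For $\psi$ with $\mathit{can}(\psi)=\psi_0\wedge\mathbf F\psi_1\wedge\dots\wedge\mathbf F\psi_k\wedge\mathbf G\psi_{k+1}$, $\mathit{prop}(\psi)=\psi_0$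 (and $\mathit{prop}(\mathit{true})=\mathit{true}$). **Canonical syntax tree.** $\mathcal T(\varphi)\subseteq\mathsf{ELTL}_{\mathsf{FT}}\times\mathbb N_0^*$ contains the root $\langle\mathit{can}(\varphi),0\rangle$; and whenever $\langle\psi,w\rangle\in\mathcal T(\varphi)$ where $\psi=\psi'=\mathit{can}(\varphi)$, or $\psi=\mathbf F\psi'$, or $\psi=\mathbf G\psi'$, with $\psi'=p\wedge\mathbf F\psi_1\wedge\dots\wedge\mathbf F\psi_k\wedge\mathbf G\psi_{k+1}$ canonical, it contains $\langle p,w.0\rangle$, $\langle\mathbf F\psi_i,w.i\rangle$ ($1\le i\le k$) and $\langle\mathbf G\psi_{k+1},w.(k+1)\rangle$. A node with id $w$ is covered by a $\mathbf G$-node if $w=u_1.u_2$ with $\langle\mathbf G\psi,u_1\rangle\in\mathcal T(\varphi)$ for some $\psi$. **Cut graphs.** A cut graph of $\varphi$ is a directed acyclic graph $(\mathcal V,\mathcal E)$ with $\mathcal V=\{\mathsf{loop}_{\mathsf{start}},\mathsf{loop}_{\mathsf{end}}\}\cup\{w:\exists\psi.\ \langle\mathbf F\psi,w\rangle\in\mathcal T(\varphi)\}$ and edges satisfying: (a) for each $\langle\mathbf F\psi,w\rangle\in\mathcal T(\varphi)$ not covered by a $\mathbf G$-node, $(w,\mathsf{loop}_{\mathsf{start}})\in\mathcal E$; (b) for each $\langle\mathbf F\psi,w\rangle$ covered by a $\mathbf G$-node, $(\mathsf{loop}_{\mathsf{start}},w),(w,\mathsf{loop}_{\mathsf{end}})\in\mathcal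 E$; (c) for each pair $\langle\mathbf F\psi_1,w\rangle,\langle\mathbf F\psi_2,w.i\rangle$ not covered by a $\mathbf G$-node, $(w,w.i)\in\mathcal E$; (d) for each pair of distinct nodes $\langle\mathbf F\psi_1,w_1\rangle,\langle\mathbf F\psi_2,w_2\rangle$ both covered by a $\mathbf G$-node, exactly one of $(w_1,w_2),(w_2,w_1)$ is in $\mathcal E$. Given a lasso $\tau\cdot\rho^\omega$, a cut function is $\zeta:\mathcal V\to\{0,\dots,|\tau|+|\rho|-1\}$ with $\zeta(\mathsf{loop}_{\mathsf{start}})=|\tau|$, $\zeta(\mathsf{loop}_{\mathsf{end}})=|\tau|+|\rho|-1$, and $\zeta(v)\le\zeta(v')$ for every $(v,v')\in\mathcal E$. **Witness.** A cut function $\zeta$ (of a cut graph of $\varphi$, for the lasso $\tau\cdot\rho^\omega$) is a witness of $\mathsf{path}(\sigma,\tau\cdot\rho^\omega)\models\varphi$ if: (C1) for $\mathit{can}(\varphi)=\psi_0\wedge\mathbf F\psi_1\wedge\dots\wedge\mathbf F\psi_k\wedge\mathbf G\psi_{k+1}$: $\sigma\models\psi_0$ and $\mathsf{Cfgs}(\sigma,\tau\cdot\rho)\models\mathit{prop}(\psi_{k+1})$; (C2) for each $\langle\mathbf F\psi,v\rangle\in\mathcal T(\varphi)$ with $\zeta(v)<|\tau|$, if $\zeta(v)$ cuts $\tau\cdot\rho$ into $\pi',\pi''$ and $\psi=\psi_0\wedge\mathbf F\psi_1\wedge\dots\wedge\mathbf F\psi_k\wedge\mathbf G\psi_{k+1}$,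 then $\pi'(\sigma)\models\psi_0$ and $\mathsf{Cfgs}(\pi'(\sigma),\pi'')\models\mathit{prop}(\psi_{k+1})$; (C3) for each $\langle\mathbf F\psi,v\rangle\in\mathcal T(\varphi)$ with $\zeta(v)\ge|\tau|$, with the same notation, $\pi'(\sigma)\models\psi_0$ and $\mathsf{Cfgs}(\tau(\sigma),\rho)\models\mathit{prop}(\psi_{k+1})$. For the lasso $(\tau\cdot\rho^K)\cdot\rho^\omega$ these definitions are applied with prefix $\tau\cdot\rho^K$ in place of $\tau$. -}

module Defs where

open import Level using (0ℓ)
open import Data.Bool.Base using (Bool; true; false; if_then_else_)
import Data.Bool.Properties as Bool
open import Data.Nat.Base using (ℕ; zero; suc; _+_; _*_; _∸_; _≤_; _<_; _≥_; NonZero)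
open import Data.Nat.DivMod using (_mod_)
open import Data.Integer.Base as ℤ using (ℤ; +_; 0ℤ)
open import Data.Fin.Base as Fin using (Fin; toℕ)
import Data.Fin.Properties as Fin
open import Data.Fin.Subset using (Subset; _∈_) renaming (⊥ to ∅)
open import Data.Vec.Base as Vec using (Vec; _∷_)
import Data.Vec.Properties as Vec
open import Data.List.Base as List
  using (List; []; _∷_; _++_; _∷ʳ_; length; concat; replicate; applyUpTo)
open import Data.List.Membership.Propositional using () renaming (_∈_ to _∈ₗ_)
open import Data.List.Relation.Unary.All using (All)
open import Data.List.Relation.Unary.Unique.Propositional using (Unique)
open import Data.Product.Base using (Σ; ∃; ∃-syntax; _×_; _,_; _,′_; proj₁)
open import Data.Sum.Base using (_⊎_)
open import Function.Bundles using (_⇔_)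
open import Relation.Nullary.Decidable.Core using (does)
open import Relation.Nullary.Negation.Core using (¬_)
open import Relation.Binary.Core using (Rel)
open import Relation.Binary.PropositionalEquality.Core using (_≡_; _≢_)
open import Relation.Binary.Construct.Closure.ReflexiveTransitive using (Star; ε; _◅_)
open import Relation.Binary.Construct.Closure.Transitive using (TransClosure)

------------------------------------------------------------------------
-- Linear integer arithmetic

record Linear (n : ℕ) : Set where
  constructor _+∑_
  field
    constant : ℤ
    coeffs   : Vec ℤ n

dot : ∀ {n} → Vec ℤ n → Vec ℤ n → ℤ
dot a v = Vec.foldr′ ℤ._+_ 0ℤ (Vec.zipWith ℤ._*_ a v)

eval : ∀ {n} → Linear n → Vec ℤ n → ℤ
eval (a₀ +∑ a) v = a₀ ℤ.+ dot a v

-- Formulas of linear integer arithmetic with n free variables.  A quantifier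
-- ranges over ℤ and binds variable 0.
data LIA (n : ℕ) : Set where
  _≤ᴸ_      : Linear n → Linear n → LIA n
  ¬ᴸ_       : LIA n → LIA n
  _∧ᴸ_ _∨ᴸ_ : LIA n → LIA n → LIA n
  ∃ᴸ ∀ᴸ     : LIA (suc n) → LIA n

infix 4 _⊨ᴸ_

_⊨ᴸ_ : ∀ {n} → Vec ℤ n → LIA n → Set
v ⊨ᴸ (s ≤ᴸ t) = eval s v ℤ.≤ eval t v
v ⊨ᴸ (¬ᴸ φ)   = ¬ (v ⊨ᴸ φ)
v ⊨ᴸ (φ ∧ᴸ ψ) = v ⊨ᴸ φ × v ⊨ᴸ ψ
v ⊨ᴸ (φ ∨ᴸ ψ) = v ⊨ᴸ φ ⊎ v ⊨ᴸ ψ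
v ⊨ᴸ (∃ᴸ φ)   = ∃[ z ] (z ∷ v) ⊨ᴸ φ
v ⊨ᴸ (∀ᴸ φ)   = ∀ z → (z ∷ v) ⊨ᴸ φ

------------------------------------------------------------------------
-- Threshold automata

-- The data (x , a₀ , a) common to the lower guard x ≥ a₀ + Σ aᵢ pᵢ and the
-- upper guard x < a₀ + Σ aᵢ pᵢ.
record Threshold (nVar nPar : ℕ) : Set where
  field
    var   : Fin nVar
    bound : Linear nPar

record Rule (nLoc nVar nPar : ℕ) : Set where
  field
    from to : Fin nLoc
    φ≤      : List (Threshold nVar nPar)   -- conjunction of lower guards
    φ>      : List (Threshold nVar nPar)   -- conjunction of upper guards
    u       : Vec ℕ nVar

module _ {nLoc nVar nPar : ℕ} (𝓡 : List (Rule nLoc nVar nPar)) where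
  open Rule

  Edge : Rel (Fin nLoc) 0ℓ
  Edge ℓ ℓ′ = ∃[ r ] r ∈ₗ 𝓡 × from r ≡ ℓ × to r ≡ ℓ′

  Path : Rel (Fin nLoc) 0ℓ
  Path = Star Edge

  visited : ∀ {ℓ ℓ′} → Path ℓ ℓ′ → List (Fin nLoc)
  visited {ℓ} ε       = ℓ ∷ []
  visited {ℓ} (_ ◅ π) = ℓ ∷ visited π

  -- A rule lies on a cycle iff a path leads from its target back to its source.
  CyclesDoNotUpdate : Set
  CyclesDoNotUpdate =
    ∀ r → r ∈ₗ 𝓡 → Path (to r) (from r) → u r ≡ Vec.replicate nVar 0

  -- Two locations on a common cycle are joined by at most one path without
  -- repeated locations; that there is at least one is automatic.  Paths are
  -- compared by the locations they visit, as parallel rules give one edge.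
  CyclesSimple : Set
  CyclesSimple =
    ∀ {ℓ ℓ′} → Path ℓ ℓ′ → Path ℓ′ ℓ →
    (π₁ π₂ : Path ℓ ℓ′) → Unique (visited π₁) → Unique (visited π₂) →
    visited π₁ ≡ visited π₂

record ThresholdAutomaton : Set where
  field
    nLoc nVar nPar    : ℕ
    𝓘                 : Subset nLoc
    RC                : LIA nPar
    𝓡                 : List (Rule nLoc nVar nPar)
    cyclesDoNotUpdate : CyclesDoNotUpdate 𝓡
    cyclesSimple      : CyclesSimple 𝓡

  Admissible : Vec ℕ nPar → Set
  Admissible p = Vec.map +_ p ⊨ᴸ RC

-- A threshold automaton with the system size N and admissible parameters p.
record CounterSystem : Set where
  field
    automaton : ThresholdAutomaton
  open ThresholdAutomaton automaton public
  field
    N          : ∃ Admissible → ℕ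
    N-coeffs   : Vec ℤ nPar
    N-linear   : ∀ q → + N q ≡ dot N-coeffs (Vec.map +_ (proj₁ q))
    p          : Vec ℕ nPar
    admissible : Admissible p

------------------------------------------------------------------------
-- ELTL_FT syntax

module Syntax (TA : ThresholdAutomaton) where
  open ThresholdAutomaton TA

  data Guard : Set where
    rise fall : Threshold nVar nPar → Guard

  data CForm : Set where
    someNonzero allZero : (Locs : Subset nLoc) → CForm
    _∧_                 : CForm → CForm → CForm

  data GForm : Set where
    guard : Guard → GForm
    ¬ᴳ_   : GForm → GForm
    _∧_   : GForm → GForm → GForm

  data PForm : Set where
    cform : CForm → PForm
    _∨_   : GForm → CForm → PForm

  infixr 6 _∧_

  data Formula : Set where
    pform : PForm → Formula
    G F   : Formula → Formula
    _∧_   : Formula → Formula → Formula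

  data Propositional : Set where
    pform : PForm → Propositional
    _∧_   : Propositional → Propositional → Propositional

  ⌜_⌝ : Propositional → Formula
  ⌜ pform p ⌝ = pform p
  ⌜ p ∧ q ⌝   = ⌜ p ⌝ ∧ ⌜ q ⌝

  trueᴾ : Propositional
  trueᴾ = pform (cform (allZero ∅))

  trueᶠ : Formula
  trueᶠ = ⌜ trueᴾ ⌝

  isTrue : Formula → Bool
  isTrue (pform (cform (allZero Locs))) = does (Vec.≡-dec Bool._≟_ Locs ∅)
  isTrue _                              = false

  -- canon p (ψ₁ ∷ … ∷ ψₖ ∷ []) χ  is  p ∧ F ψ₁ ∧ … ∧ F ψₖ ∧ G χ.
  canon : Propositional → List Formula → Formula → Formula
  canon p ψs χ = ⌜ p ⌝ ∧ List.foldr (λ ψ φ → F ψ ∧ φ) (G χ) ψs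

  data Canonical : (rank : ℕ) → Formula → Set where
    rank0 : ∀ p → Canonical 0 (canon p [] trueᶠ)
    rank1 : ∀ p ψ ψs → All (λ ψ′ → ∃[ r ] Canonical r ψ′) (ψ ∷ ψs) →
            Canonical 1 (canon p (ψ ∷ ψs) trueᶠ)
    rank2 : ∀ p ψs χ → All (λ ψ′ → ∃[ r ] Canonical r ψ′) ψs →
            Canonical 0 χ ⊎ Canonical 1 χ →
            Canonical 2 (canon p ψs χ)

  IsCanonical : Formula → Set
  IsCanonical ψ = ∃[ r ] Canonical r ψ

  propPart : ∀ {ψ} → IsCanonical ψ → Propositional
  propPart (_ , rank0 p)         = p
  propPart (_ , rank1 p _ _ _)   = p
  propPart (_ , rank2 p _ _ _ _) = p

------------------------------------------------------------------------
-- Counter systems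

module Semantics (CS : CounterSystem) where
  open CounterSystem CS
  open Syntax automaton public

  -- The parameter component of every configuration is the fixed p.
  record Config : Set where
    constructor ⟨_,_⟩
    field
      κ : Vec ℕ nLoc
      g : Vec ℕ nVar

  open Config public

  record Transition : Set where
    field
      rule   : Rule nLoc nVar nPar
      rule∈𝓡 : rule ∈ₗ 𝓡
      factor : ℕ
    open Rule rule public

  evalBound : Threshold nVar nPar → ℤ
  evalBound c = eval (Threshold.bound c) (Vec.map +_ p)

  LowerHolds UpperHolds : Config → Threshold nVar nPar → Set
  LowerHolds σ c = + Vec.lookup (g σ) (Threshold.var c) ℤ.≥ evalBound c
  UpperHolds σ c = + Vec.lookup (g σ) (Threshold.var c) ℤ.< evalBound c

  bump : Vec ℕ nVar → ℕ → Vec ℕ nVar → Vec ℕ nVar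
  bump v k u = Vec.zipWith _+_ v (Vec.map (k *_) u)

  Unlocked : Transition → Config → Set
  Unlocked t σ = ∀ k → k < factor →
      All (LowerHolds ⟨ κ σ , bump (g σ) k u ⟩) φ≤
    × All (UpperHolds ⟨ κ σ , bump (g σ) k u ⟩) φ>
    where open Transition t

  Applicable : Transition → Config → Set
  Applicable t σ = (Unlocked t σ × Vec.lookup (κ σ) from ≥ factor) ⊎ factor ≡ 0
    where open Transition t

  -- Total for convenience: t(σ) is meaningful only if t is applicable in σ, in
  -- which case the truncated subtraction is exact.
  step : Transition → Config → Config
  step t σ = ⟨ moved , bump (g σ) factor u ⟩
    where
    open Transition t
    moved : Vec ℕ nLoc
    moved = if does (from Fin.≟ to) then κ σ
            else Vec.updateAt (Vec.updateAt (κ σ) from (_∸ factor)) to (_+ factor)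

  Schedule : Set
  Schedule = List Transition

  Schedule∞ : Set
  Schedule∞ = ℕ → Transition

  run : Schedule → Config → Config
  run []      σ = σ
  run (t ∷ τ) σ = run τ (step t σ)

  take : ℕ → Schedule∞ → Schedule
  take n τ = applyUpTo τ n

  drop : ℕ → Schedule∞ → Schedule∞
  drop n τ i = τ (n + i)

  Applicable∞ : Config → Schedule∞ → Set
  Applicable∞ σ τ = ∀ i → Applicable (τ i) (run (take i τ) σ)

  infixr 5 _++∞_
  infix  8 _^_ _^ω

  _++∞_ : Schedule → Schedule∞ → Schedule∞
  ([]      ++∞ π) i       = π i
  ((t ∷ τ) ++∞ π) zero    = t
  ((t ∷ τ) ++∞ π) (suc i) = (τ ++∞ π) i

  _^_ : Schedule → ℕ → Schedule
  ρ ^ k = concat (replicate k ρ)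

  _^ω : (ρ : Schedule) .{{_ : NonZero (length ρ)}} → Schedule∞
  (ρ ^ω) i = List.lookup ρ (i mod length ρ)

  -- The infinite schedule τ · ρ^ω is a lasso applicable to σ.
  record IsLasso (σ : Config) (τ ρ : Schedule) .{{_ : NonZero (length ρ)}} : Set where
    field
      applicable : Applicable∞ σ (τ ++∞ ρ ^ω)
      returns    : ∀ k → run (ρ ^ k) (run τ σ) ≡ run τ σ

  infix 4 _⊨ᴮ_ _⊨ᶜ_ _⊨ᴳ_ _⊨ᶠ_ _⊨ᴾ_ _,_⊨_

  _⊨ᴮ_ : Config → Guard → Set
  σ ⊨ᴮ rise c = LowerHolds σ c
  σ ⊨ᴮ fall c = UpperHolds σ c

  _⊨ᶜ_ : Config → CForm → Set
  σ ⊨ᶜ someNonzero Locs = ∃[ ℓ ] ℓ ∈ Locs × Vec.lookup (κ σ) ℓ ≢ 0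
  σ ⊨ᶜ allZero Locs     = ∀ ℓ → ℓ ∈ Locs → Vec.lookup (κ σ) ℓ ≡ 0
  σ ⊨ᶜ (c ∧ d)          = σ ⊨ᶜ c × σ ⊨ᶜ d

  _⊨ᴳ_ : Config → GForm → Set
  σ ⊨ᴳ guard b = σ ⊨ᴮ b
  σ ⊨ᴳ (¬ᴳ a)  = ¬ (σ ⊨ᴳ a)
  σ ⊨ᴳ (a ∧ b) = σ ⊨ᴳ a × σ ⊨ᴳ b

  _⊨ᶠ_ : Config → PForm → Set
  σ ⊨ᶠ cform c = σ ⊨ᶜ c
  σ ⊨ᶠ (a ∨ c) = σ ⊨ᴳ a ⊎ σ ⊨ᶜ c

  _⊨ᴾ_ : Config → Propositional → Set
  σ ⊨ᴾ pform p = σ ⊨ᶠ p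
  σ ⊨ᴾ (p ∧ q) = σ ⊨ᴾ p × σ ⊨ᴾ q

  -- σ , τ ⊨ ψ is path(σ,τ) ⊨ ψ, intended for τ applicable to σ.  The
  -- decompositions τ = τ′ · τ″ with τ′ finite are the pairs take n τ, drop n τ.
  _,_⊨_ : Config → Schedule∞ → Formula → Set
  σ , τ ⊨ pform p = σ ⊨ᶠ p
  σ , τ ⊨ G ψ     = ∀ n → run (take n τ) σ , drop n τ ⊨ ψ
  σ , τ ⊨ F ψ     = ∃[ n ] run (take n τ) σ , drop n τ ⊨ ψ
  σ , τ ⊨ (φ ∧ ψ) = σ , τ ⊨ φ × σ , τ ⊨ ψ

  Equivalent : Formula → Formula → Set
  Equivalent φ ψ = ∀ σ τ → Applicable∞ σ τ → (σ , τ ⊨ φ) ⇔ (σ , τ ⊨ ψ)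

  -- Cfgs(σ,τ) ⊨ p
  Cfgs : Config → Schedule → Propositional → Set
  Cfgs σ τ p = ∀ τ′ τ″ → τ ≡ τ′ ++ τ″ → run τ′ σ ⊨ᴾ p

  Cuts : ℕ → (π π′ π″ : Schedule) → Set
  Cuts k π π′ π″ = π ≡ π′ ++ π″ × length π′ ≡ k

  record Canonisation : Set where
    field
      can        : Formula → Formula
      canonical  : ∀ φ → IsCanonical (can φ)
      equivalent : ∀ φ → Equivalent φ (can φ)

    prop : Formula → Propositional
    prop ψ = if isTrue ψ then trueᴾ else propPart (canonical ψ)

------------------------------------------------------------------------
-- Syntax trees, cut graphs and witnesses

module Witnesses (CS : CounterSystem) (C : Semantics.Canonisation CS) where
  open Semantics CS
  open Canonisation C

  Word : Set
  Word = List ℕ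

  Unfolds : (φ ψ ψ′ : Formula) → Set
  Unfolds φ ψ ψ′ = (ψ ≡ ψ′ × ψ′ ≡ can φ) ⊎ ψ ≡ F ψ′ ⊎ ψ ≡ G ψ′

  -- 𝒯 φ ψ w  means  ⟨ψ,w⟩ ∈ 𝒯(φ).
  data 𝒯 (φ : Formula) : Formula → Word → Set where
    root      : 𝒯 φ (can φ) (0 ∷ [])
    prop-node : ∀ {ψ w} p ψs χ → 𝒯 φ ψ w → Unfolds φ ψ (canon p ψs χ) →
                IsCanonical (canon p ψs χ) →
                𝒯 φ ⌜ p ⌝ (w ∷ʳ 0)
    F-node    : ∀ {ψ w} p ψs χ → 𝒯 φ ψ w → Unfolds φ ψ (canon p ψs χ) →
                IsCanonical (canon p ψs χ) →
                (i : Fin (length ψs)) →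
                𝒯 φ (F (List.lookup ψs i)) (w ∷ʳ suc (toℕ i))
    G-node    : ∀ {ψ w} p ψs χ → 𝒯 φ ψ w → Unfolds φ ψ (canon p ψs χ) →
                IsCanonical (canon p ψs χ) →
                𝒯 φ (G χ) (w ∷ʳ suc (length ψs))

  Covered : Formula → Word → Set
  Covered φ w = ∃[ u₁ ] ∃[ u₂ ] w ≡ u₁ ++ u₂ × (∃[ ψ ] 𝒯 φ (G ψ) u₁)

  FWord : Formula → Word → Set
  FWord φ w = ∃[ ψ ] 𝒯 φ (F ψ) w

  -- The membership proof is irrelevant, so vertices are determined by their words.
  data Vertex (φ : Formula) : Set where
    loopStart loopEnd : Vertex φ
    node              : (w : Word) → .(FWord φ w) → Vertex φ

  record CutGraph (φ : Formula) : Set₁ where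
    field
      E       : Rel (Vertex φ) 0ℓ
      acyclic : ∀ v → ¬ TransClosure E v v
      edge-a  : ∀ {ψ w} (m : 𝒯 φ (F ψ) w) → ¬ Covered φ w →
                E (node w (ψ , m)) loopStart
      edge-b  : ∀ {ψ w} (m : 𝒯 φ (F ψ) w) → Covered φ w →
                E loopStart (node w (ψ , m)) × E (node w (ψ , m)) loopEnd
      edge-c  : ∀ {ψ₁ ψ₂ w i} (m₁ : 𝒯 φ (F ψ₁) w) (m₂ : 𝒯 φ (F ψ₂) (w ∷ʳ i)) →
                ¬ Covered φ w → ¬ Covered φ (w ∷ʳ i) →
                E (node w (ψ₁ , m₁)) (node (w ∷ʳ i) (ψ₂ , m₂))
      edge-d  : ∀ {ψ₁ ψ₂ w₁ w₂} (m₁ : 𝒯 φ (F ψ₁) w₁) (m₂ : 𝒯 φ (F ψ₂) w₂) →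
                (F ψ₁ ,′ w₁) ≢ (F ψ₂ ,′ w₂) → Covered φ w₁ → Covered φ w₂ →
                let v₁ = node w₁ (ψ₁ , m₁)
                    v₂ = node w₂ (ψ₂ , m₂)
                in (E v₁ v₂ × ¬ E v₂ v₁) ⊎ (E v₂ v₁ × ¬ E v₁ v₂)

  -- Cut functions for the lasso τ · ρ^ω
  record CutFunction {φ : Formula} (𝒢 : CutGraph φ) (τ ρ : Schedule) : Set where
    open CutGraph 𝒢
    field
      ζ        : Vertex φ → Fin (length τ + length ρ)
      ζ-start  : toℕ (ζ loopStart) ≡ length τ
      ζ-end    : toℕ (ζ loopEnd) ≡ length τ + length ρ ∸ 1
      monotone : ∀ {v v′} → E v v′ → ζ v Fin.≤ ζ v′

  record IsWitness {φ : Formula} {𝒢 : CutGraph φ} (σ : Config) (τ ρ : Schedule)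
                   (Z : CutFunction 𝒢 τ ρ) : Set where
    open CutFunction Z
    field
      C1 : ∀ ψ₀ ψs χ → can φ ≡ canon ψ₀ ψs χ →
           σ ⊨ᴾ ψ₀ × Cfgs σ (τ ++ ρ) (prop χ)
      C2 : ∀ ψ₀ ψs χ {v} (m : 𝒯 φ (F (canon ψ₀ ψs χ)) v) →
           let k = toℕ (ζ (node v (_ , m))) in
           k < length τ →
           ∀ π′ π″ → Cuts k (τ ++ ρ) π′ π″ →
           run π′ σ ⊨ᴾ ψ₀ × Cfgs (run π′ σ) π″ (prop χ)
      C3 : ∀ ψ₀ ψs χ {v} (m : 𝒯 φ (F (canon ψ₀ ψs χ)) v) →
           let k = toℕ (ζ (node v (_ , m))) in
           k ≥ length τ →
           ∀ π′ π″ → Cuts k (τ ++ ρ) π′ π″ →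
           run π′ σ ⊨ᴾ ψ₀ × Cfgs (run τ σ) ρ (prop χ)

  -- There is a witness of path(σ, τ · ρ^ω) ⊨ φ.
  HasWitness : Formula → Config → (τ ρ : Schedule) → Set₁
  HasWitness φ σ τ ρ = Σ (CutGraph φ) λ 𝒢 → Σ (CutFunction 𝒢 τ ρ) (IsWitness σ τ ρ)

{-# OPTIONS --safe #-}
module Submission where

-- Unfold can(φ) along its syntax tree, choosing for every F-node a position of
-- the infinite path at which its body holds; below a G-node the position is
-- chosen in the loop.  Only finitely many positions belong to F-nodes that are
-- not covered by a G-node, so for large K they all lie within τ · ρ^K, and the
-- positions of the covered ones are reduced modulo |ρ| into the loop that
-- follows.  Reading off the order of the positions (ties broken by words) gives
-- the cut graph.

open import Defs
open import Data.Bool.Base using (Bool; true; false; if_then_else_)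
open import Data.Empty using (⊥-elim)
open import Data.Fin.Base using (Fin; zero; suc; toℕ; fromℕ<)
open import Data.Fin.Properties using (toℕ-fromℕ<; fromℕ<-cong)
open import Data.Fin.Subset.Properties using (∉⊥)
open import Data.List.Base as List using (List; []; _∷_; _++_; _∷ʳ_; length; foldl; foldr)
open import Data.List.Properties using (∷-injective; length-++; ++-assoc; ++-identityʳ; foldl-++; foldl-∷ʳ)
open import Data.List.Relation.Binary.Lex.Strict
  using (Lex-<; halt; this; next; <-compare; <-irreflexive; <-transitive; <-asymmetric)
open import Data.List.Relation.Binary.Pointwise using (Pointwise-≡⇒≡; ≡⇒Pointwise-≡)
open import Data.Nat.Base
  using (ℕ; zero; suc; _+_; _*_; _∸_; _⊔_; _≤_; _<_; _≥_; NonZero; z≤n; s≤s; >-nonZero⁻¹)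
open import Data.Nat.DivMod
  using (_/_; _%_; m%n<n; m≡m%n+[m/n]*n; m<n⇒m%n≡m; [m+n]%n≡m%n)
open import Data.Nat.Properties
open import Data.Product.Base using (Σ; ∃-syntax; _×_; _,_; proj₁; proj₂)
open import Data.Sum.Base using (_⊎_; inj₁; inj₂)
open import Function.Base using (id; _∘_)
open import Function.Bundles using (Equivalence)
open import Level using (0ℓ)
open import Relation.Binary.Core using (Rel)
open import Relation.Binary.Construct.Closure.Transitive using (TransClosure; [_]; _∷_)
open import Relation.Binary.Definitions using (tri<; tri≈; tri>)
open import Relation.Binary.PropositionalEquality
open import Relation.Nullary.Negation.Core using (¬_; contradiction)

-- Strict lexicographic order on words of natural numbers.

infix 4 _≺_

_≺_ : Rel (List ℕ) 0ℓ
_≺_ = Lex-< _≡_ _<_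

≺-trans : ∀ {xs ys zs} → xs ≺ ys → ys ≺ zs → xs ≺ zs
≺-trans = <-transitive isEquivalence (resp₂ _<_) <-trans

≺-irrefl : ∀ {xs} → ¬ xs ≺ xs
≺-irrefl = <-irreflexive <-irrefl (≡⇒Pointwise-≡ refl)

≺-asym : ∀ {xs ys} → xs ≺ ys → ¬ ys ≺ xs
≺-asym = <-asymmetric sym (resp₂ _<_) <-asym

≺-connex : ∀ {xs ys} → xs ≢ ys → xs ≺ ys ⊎ ys ≺ xs
≺-connex {xs} {ys} xs≢ys with <-compare sym <-cmp xs ys
... | tri< lt _ _ = inj₁ lt
... | tri≈ _ eq _ = contradiction (Pointwise-≡⇒≡ eq) xs≢ys
... | tri> _ _ gt = inj₂ gt

-- The head of a vertex key will be its position. A weak inequality of positions together with a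
-- tie-break therefore yields an edge, and by `∷-cancel-≺` an edge never lowers the position.
∷-mono-≺ : ∀ {a b xs ys} → a ≤ b → xs ≺ ys → a ∷ xs ≺ b ∷ ys
∷-mono-≺ a≤b xs≺ys with m≤n⇒m<n∨m≡n a≤b
... | inj₁ a<b = this a<b
... | inj₂ a≡b = next a≡b xs≺ys

∷-cancel-≺ : ∀ {a b xs ys} → a ∷ xs ≺ b ∷ ys → a ≤ b
∷-cancel-≺ (this a<b)   = <⇒≤ a<b
∷-cancel-≺ (next a≡b _) = ≤-reflexive a≡b

xs≺xs∷ʳx : ∀ xs {x} → xs ≺ xs ∷ʳ x
xs≺xs∷ʳx []       = halt
xs≺xs∷ʳx (x ∷ xs) = next refl (xs≺xs∷ʳx xs)

-- Finite and infinite schedules.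

module Schedules (CS : CounterSystem) where
  open Semantics CS

  run-++ : ∀ τ τ′ σ → run (τ ++ τ′) σ ≡ run τ′ (run τ σ)
  run-++ []      τ′ σ = refl
  run-++ (t ∷ τ) τ′ σ = run-++ τ τ′ (step t σ)

  take-cong : ∀ n {π π′ : Schedule∞} → π ≗ π′ → take n π ≡ take n π′
  take-cong zero    π≗π′ = refl
  take-cong (suc n) π≗π′ = cong₂ _∷_ (π≗π′ 0) (take-cong n (π≗π′ ∘ suc))

  run-take-+ : ∀ n m π σ → run (take m (drop n π)) (run (take n π) σ) ≡ run (take (n + m) π) σ
  run-take-+ zero    m π σ = refl
  run-take-+ (suc n) m π σ = run-take-+ n m (π ∘ suc) (step (π 0) σ)

  run-take-++∞ : ∀ τ j π σ → run (take (length τ + j) (τ ++∞ π)) σ ≡ run (take j π) (run τ σ)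
  run-take-++∞ []      j π σ = refl
  run-take-++∞ (t ∷ τ) j π σ = run-take-++∞ τ j π (step t σ)

  ++∞-congʳ : ∀ τ {π π′ : Schedule∞} → π ≗ π′ → τ ++∞ π ≗ τ ++∞ π′
  ++∞-congʳ []      π≗π′ i       = π≗π′ i
  ++∞-congʳ (t ∷ τ) π≗π′ zero    = refl
  ++∞-congʳ (t ∷ τ) π≗π′ (suc i) = ++∞-congʳ τ π≗π′ i

  ++∞-assoc : ∀ τ τ′ π → (τ ++ τ′) ++∞ π ≗ τ ++∞ τ′ ++∞ π
  ++∞-assoc []      τ′ π i       = refl
  ++∞-assoc (t ∷ τ) τ′ π zero    = refl
  ++∞-assoc (t ∷ τ) τ′ π (suc i) = ++∞-assoc τ τ′ π i

  ++∞-unique : ∀ τ {π θ : Schedule∞} →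
               (∀ {i} (i<τ : i < length τ) → List.lookup τ (fromℕ< i<τ) ≡ θ i) →
               (∀ j → π j ≡ θ (length τ + j)) → τ ++∞ π ≗ θ
  ++∞-unique []      head tail i       = tail i
  ++∞-unique (t ∷ τ) head tail zero    = head (s≤s z≤n)
  ++∞-unique (t ∷ τ) head tail (suc i) = ++∞-unique τ (λ i<τ → head (s≤s i<τ)) tail i

  module _ (ρ : Schedule) .{{_ : NonZero (length ρ)}} where

    -- Below `length ρ` an index is its own remainder, and a shift by `length ρ` preserves
    -- remainders.
    ^ω-unroll : ρ ++∞ ρ ^ω ≗ ρ ^ω
    ^ω-unroll = ++∞-unique ρ
      (λ {i} i<ρ → cong (List.lookup ρ) (fromℕ<-cong _ _ (sym (m<n⇒m%n≡m i<ρ)) _ _))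
      (λ j → cong (List.lookup ρ) (fromℕ<-cong _ _ (period j) _ _))
      where
      period : ∀ j → j % length ρ ≡ (length ρ + j) % length ρ
      period j = sym (trans (cong (_% length ρ) (+-comm (length ρ) j)) ([m+n]%n≡m%n j (length ρ)))

    ^ω-unroll-^ : ∀ k → ρ ^ k ++∞ ρ ^ω ≗ ρ ^ω
    ^ω-unroll-^ zero    i = refl
    ^ω-unroll-^ (suc k) i =
      trans (++∞-assoc ρ (ρ ^ k) (ρ ^ω) i)
        (trans (++∞-congʳ ρ (^ω-unroll-^ k) i) (^ω-unroll i))

    length-^ : ∀ k → length (ρ ^ k) ≡ k * length ρ
    length-^ zero    = refl
    length-^ (suc k) = trans (length-++ ρ) (cong (length ρ +_) (length-^ k))

    k≤length-^ : ∀ k → k ≤ length (ρ ^ k)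
    k≤length-^ k rewrite length-^ k = m≤m*n k (length ρ)

  -- Satisfaction at absolute positions of a path.

  module Path (σ : Config) (π : Schedule∞) where

    at : ℕ → Config
    at n = run (take n π) σ

    -- The semantics of ELTL_FT with every suffix of the path replaced by its
    -- absolute starting position, so that suffixes of suffixes need no transport.
    Holds : ℕ → Formula → Set
    Holds n (pform p) = at n ⊨ᶠ p
    Holds n (G ψ)     = ∀ m → n ≤ m → Holds m ψ
    Holds n (F ψ)     = ∃[ m ] n ≤ m × Holds m ψ
    Holds n (φ ∧ ψ)   = Holds n φ × Holds n ψ

    private
      at-shift : ∀ {n σ′ τ} k → σ′ ≡ at n → τ ≗ drop n π → run (take k τ) σ′ ≡ at (n + k)
      at-shift {n} k refl τ≗ =
        trans (cong (λ τ → run τ (at n)) (take-cong k τ≗)) (run-take-+ n k π σ)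

      drop-shift : ∀ {n τ} k → τ ≗ drop n π → drop k τ ≗ drop (n + k) π
      drop-shift {n} k τ≗ i = trans (τ≗ (k + i)) (cong π (sym (+-assoc n k i)))

    -- Iterated drops agree with a single drop only pointwise. The induction is therefore over any
    -- `τ` with `τ ≗ drop n π`, a hypothesis that each temporal case can pass on.
    ⊨⇒Holds : ∀ ψ {n σ′ τ} → σ′ ≡ at n → τ ≗ drop n π → σ′ , τ ⊨ ψ → Holds n ψ
    ⊨⇒Holds (pform p) refl τ≗ h = h
    ⊨⇒Holds (G ψ) eq τ≗ h m n≤m with k , refl ← m≤n⇒∃[o]m+o≡n n≤m =
      ⊨⇒Holds ψ (at-shift k eq τ≗) (drop-shift k τ≗) (h k)
    ⊨⇒Holds (F ψ) {n} eq τ≗ (k , h) =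
      n + k , m≤m+n n k , ⊨⇒Holds ψ (at-shift k eq τ≗) (drop-shift k τ≗) h
    ⊨⇒Holds (φ ∧ ψ) eq τ≗ (h , h′) = ⊨⇒Holds φ eq τ≗ h , ⊨⇒Holds ψ eq τ≗ h′

    Holds⇒⊨ : ∀ ψ {n σ′ τ} → σ′ ≡ at n → τ ≗ drop n π → Holds n ψ → σ′ , τ ⊨ ψ
    Holds⇒⊨ (pform p) refl τ≗ h = h
    Holds⇒⊨ (G ψ) {n} eq τ≗ h k =
      Holds⇒⊨ ψ (at-shift k eq τ≗) (drop-shift k τ≗) (h (n + k) (m≤m+n n k))
    Holds⇒⊨ (F ψ) eq τ≗ (m , n≤m , h) with k , refl ← m≤n⇒∃[o]m+o≡n n≤m =
      k , Holds⇒⊨ ψ (at-shift k eq τ≗) (drop-shift k τ≗) h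
    Holds⇒⊨ (φ ∧ ψ) eq τ≗ (h , h′) = Holds⇒⊨ φ eq τ≗ h , Holds⇒⊨ ψ eq τ≗ h′

    Holds-⌜⌝ : ∀ p {n} → Holds n ⌜ p ⌝ → at n ⊨ᴾ p
    Holds-⌜⌝ (pform p) h        = h
    Holds-⌜⌝ (p ∧ q)   (h , h′) = Holds-⌜⌝ p h , Holds-⌜⌝ q h′

    Holds-propPart : ∀ {ψ} (c : IsCanonical ψ) {n} → Holds n ψ → at n ⊨ᴾ propPart c
    Holds-propPart (_ , rank0 p)         (h , _) = Holds-⌜⌝ p h
    Holds-propPart (_ , rank1 p _ _ _)   (h , _) = Holds-⌜⌝ p h
    Holds-propPart (_ , rank2 p _ _ _ _) (h , _) = Holds-⌜⌝ p h

    Holds-canon-G : ∀ ψs {χ n} → Holds n (foldr (λ ψ φ → F ψ ∧ φ) (G χ) ψs) → Holds n (G χ)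
    Holds-canon-G []       h       = h
    Holds-canon-G (ψ ∷ ψs) (_ , h) = Holds-canon-G ψs h

    module _ (C : Canonisation) (app : Applicable∞ σ π) where
      open Canonisation C

      -- Equivalence of formulas speaks of applicable schedules only, so it is invoked on the suffix
      -- from `n`, which inherits applicability from the whole path.
      Holds-can : ∀ ψ {n} → Holds n ψ → Holds n (can ψ)
      Holds-can ψ {n} h = ⊨⇒Holds (can ψ) refl (λ _ → refl)
        (Equivalence.to (equivalent ψ (at n) (drop n π) suffix-app)
          (Holds⇒⊨ ψ refl (λ _ → refl) h))
        where
        suffix-app : Applicable∞ (at n) (drop n π)
        suffix-app i = subst (Applicable (π (n + i))) (sym (run-take-+ n i π σ)) (app (n + i))

      Holds-prop : ∀ ψ {n} → Holds n ψ → at n ⊨ᴾ prop ψ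
      Holds-prop ψ h with isTrue ψ
      -- `trueᴾ` asks for zero counters on the empty set of locations.
      ... | true  = λ ℓ ℓ∈∅ → ⊥-elim (∉⊥ ℓ∈∅)
      ... | false = Holds-propPart (canonical ψ) (Holds-can ψ h)

  -- Lassos and their unrollings.

  module Lasso (σ : Config) (τ ρ : Schedule) .{{_ : NonZero (length ρ)}}
               (lasso : IsLasso σ τ ρ) where
    open IsLasso lasso public

    open Path σ (τ ++∞ ρ ^ω) public

    loop : ℕ → Config
    loop j = run (take j (ρ ^ω)) (run τ σ)

    private
      unroll : ∀ K → τ ++∞ ρ ^ω ≗ (τ ++ ρ ^ K) ++∞ ρ ^ω
      unroll K i = sym (trans (++∞-assoc τ (ρ ^ K) (ρ ^ω) i) (++∞-congʳ τ (^ω-unroll-^ ρ K) i))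

      unroll-ρ : ∀ K → τ ++∞ ρ ^ω ≗ ((τ ++ ρ ^ K) ++ ρ) ++∞ ρ ^ω
      unroll-ρ K i = trans (unroll K i)
        (sym (trans (++∞-assoc (τ ++ ρ ^ K) ρ (ρ ^ω) i) (++∞-congʳ (τ ++ ρ ^ K) (^ω-unroll ρ) i)))

    -- The first `K` rounds of the loop lead back to `run τ σ`, so what follows them looks the same
    -- for every `K`.
    at-unrolled : ∀ K j → at (length (τ ++ ρ ^ K) + j) ≡ loop j
    at-unrolled K j = begin
      at (length τ′ + j)                                ≡⟨ cong (λ α → run α σ) (take-cong (length τ′ + j) (unroll K)) ⟩
      run (take (length τ′ + j) (τ′ ++∞ ρ ^ω)) σ        ≡⟨ run-take-++∞ τ′ j (ρ ^ω) σ ⟩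
      run (take j (ρ ^ω)) (run τ′ σ)                    ≡⟨ cong (run (take j (ρ ^ω))) (run-++ τ (ρ ^ K) σ) ⟩
      run (take j (ρ ^ω)) (run (ρ ^ K) (run τ σ))       ≡⟨ cong (run (take j (ρ ^ω))) (returns K) ⟩
      loop j                                            ∎
      where
      open ≡-Reasoning
      τ′ = τ ++ ρ ^ K

    at-loop : ∀ j → at (length τ + j) ≡ loop j
    at-loop j = run-take-++∞ τ j (ρ ^ω) σ

    -- With `K` the quotient `j / length ρ` in `at-unrolled`, the remainder after the unrolled
    -- prefix is the very position `length τ + j`.
    loop-% : ∀ j → loop (j % length ρ) ≡ loop j
    loop-% j = begin
      loop r                                  ≡⟨ at-unrolled q r ⟨
      at (length (τ ++ ρ ^ q) + r)            ≡⟨ cong at position ⟩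
      at (length τ + j)                       ≡⟨ at-loop j ⟩
      loop j                                  ∎
      where
      open ≡-Reasoning
      r = j % length ρ
      q = j / length ρ
      position : length (τ ++ ρ ^ q) + r ≡ length τ + j
      position = begin
        length (τ ++ ρ ^ q) + r            ≡⟨ cong (_+ r) (length-++ τ) ⟩
        (length τ + length (ρ ^ q)) + r    ≡⟨ cong (λ l → (length τ + l) + r) (length-^ ρ q) ⟩
        (length τ + q * length ρ) + r      ≡⟨ +-assoc (length τ) _ r ⟩
        length τ + (q * length ρ + r)      ≡⟨ cong (length τ +_) (+-comm _ r) ⟩
        length τ + (r + q * length ρ)      ≡⟨ cong (length τ +_) (m≡m%n+[m/n]*n j (length ρ)) ⟨
        length τ + j                       ∎

    -- A prefix of the finite schedule is also a prefix of the infinite one, as unrolling the loop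
    -- `K` times and once more leaves the latter unchanged.
    at-prefix : ∀ K α β → (τ ++ ρ ^ K) ++ ρ ≡ α ++ β → run α σ ≡ at (length α)
    at-prefix K α β eq = sym (begin
      at (length α)                                               ≡⟨ cong at (+-identityʳ (length α)) ⟨
      at (length α + 0)                                           ≡⟨ cong (λ γ → run γ σ) (take-cong (length α + 0) split) ⟩
      run (take (length α + 0) (α ++∞ β ++∞ ρ ^ω)) σ              ≡⟨ run-take-++∞ α 0 (β ++∞ ρ ^ω) σ ⟩
      run α σ                                                     ∎)
      where
      open ≡-Reasoning
      split : τ ++∞ ρ ^ω ≗ α ++∞ β ++∞ ρ ^ω
      split i = trans (unroll-ρ K i)
        (trans (cong (λ γ → (γ ++∞ ρ ^ω) i) eq) (++∞-assoc α β (ρ ^ω) i))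

    module _ (C : Canonisation) where
      open Canonisation C

      -- Every configuration visited after `α` sits at a position of at least `length α`, hence in
      -- the range of the G-formula.
      G⇒Cfgs-from : ∀ K χ {n} → Holds n (G χ) →
                    ∀ α β → (τ ++ ρ ^ K) ++ ρ ≡ α ++ β → n ≤ length α →
                    Cfgs (run α σ) β (prop χ)
      G⇒Cfgs-from K χ h α β eq n≤α γ δ β≡ = subst (_⊨ᴾ prop χ) (sym same)
        (Holds-prop C applicable χ (h _ (≤-trans n≤α later)))
        where
        same : run γ (run α σ) ≡ at (length (α ++ γ))
        same = trans (sym (run-++ α γ σ))
          (at-prefix K (α ++ γ) δ (trans eq (trans (cong (α ++_) β≡) (sym (++-assoc α γ δ)))))
        later : length α ≤ length (α ++ γ)
        later = subst (length α ≤_) (sym (length-++ α)) (m≤m+n _ _)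

      -- Whatever the position n, each configuration of the loop recurs after n.
      G⇒Cfgs-loop : ∀ K χ {n} → Holds n (G χ) → Cfgs (run (τ ++ ρ ^ K) σ) ρ (prop χ)
      G⇒Cfgs-loop K χ {n} h γ δ ρ≡ = subst (_⊨ᴾ prop χ) (sym same)
        (Holds-prop C applicable χ (h _ late))
        where
        open ≡-Reasoning
        τ′ = τ ++ ρ ^ K
        same : run γ (run τ′ σ) ≡ at (length (τ ++ ρ ^ n) + length γ)
        same = begin
          run γ (run τ′ σ)                     ≡⟨ run-++ τ′ γ σ ⟨
          run (τ′ ++ γ) σ                      ≡⟨ at-prefix K (τ′ ++ γ) δ (trans (cong (τ′ ++_) ρ≡) (sym (++-assoc τ′ γ δ))) ⟩
          at (length (τ′ ++ γ))                ≡⟨ cong at (length-++ τ′) ⟩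
          at (length τ′ + length γ)            ≡⟨ at-unrolled K (length γ) ⟩
          loop (length γ)                      ≡⟨ at-unrolled n (length γ) ⟨
          at (length (τ ++ ρ ^ n) + length γ)  ∎
        late : n ≤ length (τ ++ ρ ^ n) + length γ
        late = ≤-trans (k≤length-^ ρ n)
          (≤-trans (m≤n+m _ (length τ)) (≤-trans (≤-reflexive (sym (length-++ τ))) (m≤m+n _ _)))

  -- Choosing positions along the syntax tree.

  -- A G-node at position n is evaluated from n + T on; for a lasso with prefix
  -- length T this puts the whole subtree of the G-node inside the loop.
  module Unfolding (σ : Config) (π : Schedule∞) (T : ℕ) where
    open Path σ π

    -- The state reached by following a word down the tree. `body` is the node's formula without its
    -- leading F or G, and `late` keeps covered nodes inside the loop.
    record Node : Set where
      constructor mkNode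
      field
        covered : Bool
        pos     : ℕ
        body    : Formula
        late    : covered ≡ true → T ≤ pos
        holds   : Holds pos body

    open Node public

    -- Junk value that keeps child total: words outside the tree may lead here.
    barren : Node → Node
    barren (mkNode c n _ l _) = mkNode c n trueᶠ l (λ ℓ ℓ∈∅ → ⊥-elim (∉⊥ ℓ∈∅))

    enter : Node → Node
    enter (mkNode c n (F ψ) l (m , n≤m , h)) = mkNode c m ψ (λ eq → ≤-trans (l eq) n≤m) h
    enter (mkNode c n (G ψ) l h) =
      mkNode true (n + T) ψ (λ _ → m≤n+m T n) (h (n + T) (m≤m+n n T))
    enter v = barren v

    -- Canonical formulas are right-nested conjunctions: the index counts the conjuncts to skip, and
    -- the conjunct found is entered.
    child : Node → ℕ → Node
    child (mkNode c n (φ ∧ ψ) l (h , _)) zero    = enter (mkNode c n φ l h)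
    child (mkNode c n (φ ∧ ψ) l (_ , h)) (suc i) = child (mkNode c n ψ l h) i
    child v                              i       = enter v

    descendant : Node → List ℕ → Node
    descendant = foldl child

    infix 4 _⊑_

    _⊑_ : Node → Node → Set
    u ⊑ v = pos u ≤ pos v × (covered u ≡ true → covered v ≡ true)

    enter-⊑ : ∀ v → v ⊑ enter v
    enter-⊑ (mkNode c n (F ψ) l (m , n≤m , h)) = n≤m , id
    enter-⊑ (mkNode c n (G ψ) l h)             = m≤m+n n T , λ _ → refl
    enter-⊑ (mkNode c n (pform p) l h)         = ≤-refl , id
    enter-⊑ (mkNode c n (φ ∧ ψ) l h)           = ≤-refl , id

    child-⊑ : ∀ v i → v ⊑ child v i
    child-⊑ (mkNode c n (φ ∧ ψ) l (h , _)) zero    = enter-⊑ (mkNode c n φ l h)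
    child-⊑ (mkNode c n (φ ∧ ψ) l (_ , h)) (suc i) = child-⊑ (mkNode c n ψ l h) i
    child-⊑ v@(mkNode c n (F ψ) l h)       i       = enter-⊑ v
    child-⊑ v@(mkNode c n (G ψ) l h)       i       = enter-⊑ v
    child-⊑ v@(mkNode c n (pform p) l h)   i       = enter-⊑ v

    descendant-covered : ∀ w v → covered v ≡ true → covered (descendant v w) ≡ true
    descendant-covered []      v eq = eq
    descendant-covered (i ∷ w) v eq = descendant-covered w (child v i) (proj₂ (child-⊑ v i) eq)

    descendant-barren : ∀ w v → descendant (barren v) w ≡ barren v
    descendant-barren []      v = refl
    descendant-barren (_ ∷ w) v = descendant-barren w v

    Bounded : ℕ → Node → Set
    Bounded B v = covered v ≡ false → pos v ≤ B

    barren-bounded : ∀ v w → Bounded (pos v) (descendant (barren v) w)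
    barren-bounded v w _ = ≤-reflexive (cong pos (descendant-barren w v))

    mutual
      -- One bound must serve all of the infinitely many words. It is a maximum over the finitely
      -- many subformulas: an F contributes its chosen position, everything below a G is covered,
      -- and barren nodes stay where they are.
      bound-descendants : ∀ ψ c n l h → ∃[ B ] ∀ w → Bounded B (descendant (mkNode c n ψ l h) w)
      bound-descendants ψ c n l h with bound-children ψ c n l h
      ... | B , b = n ⊔ B , λ where
        []      _  → m≤m⊔n n B
        (i ∷ w) eq → ≤-trans (b i w eq) (m≤n⊔m n B)

      bound-children : ∀ ψ c n l h →
        ∃[ B ] ∀ i w → Bounded B (descendant (child (mkNode c n ψ l h) i) w)
      bound-children (φ ∧ ψ) c n l (h , h′)
        with bound-entered φ c n l h | bound-children ψ c n l h′
      ... | A , a | B , b = A ⊔ B , λ where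
        zero    w eq → ≤-trans (a w eq) (m≤m⊔n A B)
        (suc i) w eq → ≤-trans (b i w eq) (m≤n⊔m A B)
      bound-children (F ψ) c n l h     = let A , a = bound-entered (F ψ) c n l h in A , λ _ → a
      bound-children (G ψ) c n l h     = let A , a = bound-entered (G ψ) c n l h in A , λ _ → a
      bound-children (pform p) c n l h = let A , a = bound-entered (pform p) c n l h in A , λ _ → a

      bound-entered : ∀ ψ c n l h →
        ∃[ B ] ∀ w → Bounded B (descendant (enter (mkNode c n ψ l h)) w)
      bound-entered (F ψ) c n l (m , n≤m , h) = bound-descendants ψ c m _ h
      -- Any bound would do here, since no descendant is uncovered.
      bound-entered (G ψ) c n l h = 0 , λ w eq →
        contradiction (trans (sym eq) (descendant-covered w (enter (mkNode c n (G ψ) l h)) refl)) λ ()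
      bound-entered (pform p) c n l h = n , barren-bounded (mkNode c n (pform p) l h)
      bound-entered (φ ∧ ψ)   c n l h = n , barren-bounded (mkNode c n (φ ∧ ψ) l h)

    private
      Eventualities : List Formula → Formula → Formula
      Eventualities ψs χ = foldr (λ ψ φ → F ψ ∧ φ) (G χ) ψs

      child-Eventualities-F : ∀ ψs {χ} v → body v ≡ Eventualities ψs χ → (i : Fin (length ψs)) →
        let u = child v (toℕ i) in body u ≡ List.lookup ψs i × covered u ≡ covered v
      child-Eventualities-F (ψ ∷ ψs) (mkNode c n _ l h) refl zero = refl , refl
      child-Eventualities-F (ψ ∷ ψs) {χ} (mkNode c n _ l (_ , h)) refl (suc i) =
        child-Eventualities-F ψs (mkNode c n (Eventualities ψs χ) l h) refl i

      child-Eventualities-G : ∀ ψs {χ} v → body v ≡ Eventualities ψs χ →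
        let u = child v (length ψs) in body u ≡ χ × covered u ≡ true
      child-Eventualities-G [] (mkNode c n _ l h) refl = refl , refl
      child-Eventualities-G (ψ ∷ ψs) {χ} (mkNode c n _ l (_ , h)) refl =
        child-Eventualities-G ψs (mkNode c n (Eventualities ψs χ) l h) refl

    child-F : ∀ {p} ψs {χ} v → body v ≡ canon p ψs χ → (i : Fin (length ψs)) →
      let u = child v (suc (toℕ i)) in body u ≡ List.lookup ψs i × covered u ≡ covered v
    child-F ψs {χ} (mkNode c n _ l (_ , h)) refl =
      child-Eventualities-F ψs (mkNode c n (Eventualities ψs χ) l h) refl

    child-G : ∀ {p} ψs {χ} v → body v ≡ canon p ψs χ →
      let u = child v (suc (length ψs)) in body u ≡ χ × covered u ≡ true
    child-G ψs {χ} (mkNode c n _ l (_ , h)) refl =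
      child-Eventualities-G ψs (mkNode c n (Eventualities ψs χ) l h) refl

-- Agreement of the chosen nodes with the syntax tree.

module Witness (CS : CounterSystem) (C : Semantics.Canonisation CS) where
  open Semantics CS
  open Canonisation C
  open Witnesses CS C
  open Schedules CS

  private
    ∧-injectiveˡ : ∀ {φ ψ φ′ ψ′ : Formula} → φ ∧ ψ ≡ φ′ ∧ ψ′ → φ ≡ φ′
    ∧-injectiveˡ refl = refl

    ∧-injectiveʳ : ∀ {φ ψ φ′ ψ′ : Formula} → φ ∧ ψ ≡ φ′ ∧ ψ′ → ψ ≡ ψ′
    ∧-injectiveʳ refl = refl

  ⌜⌝≢F : ∀ q {ψ} → ⌜ q ⌝ ≢ F ψ
  ⌜⌝≢F (pform _) ()
  ⌜⌝≢F (_ ∧ _)   ()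

  ⌜⌝≢G : ∀ q {ψ} → ⌜ q ⌝ ≢ G ψ
  ⌜⌝≢G (pform _) ()
  ⌜⌝≢G (_ ∧ _)   ()

  -- A canonical formula ends in a G, which a propositional one cannot contain. This keeps
  -- proposition nodes from being mistaken for the root.
  ⌜⌝≢canon : ∀ q {p} ψs {χ} → ⌜ q ⌝ ≢ canon p ψs χ
  ⌜⌝≢canon (pform _) ψs ()
  ⌜⌝≢canon (q ∧ q′) [] eq = ⌜⌝≢G q′ (∧-injectiveʳ eq)
  ⌜⌝≢canon (q ∧ (q₁ ∧ q₂)) (ψ ∷ ψs) eq = ⌜⌝≢F q₁ (∧-injectiveˡ (∧-injectiveʳ eq))
  ⌜⌝≢canon (q ∧ pform _) (ψ ∷ ψs) eq with () ← ∧-injectiveʳ eq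

  canonical-≢F : ∀ {φ ψ} → IsCanonical φ → φ ≢ F ψ
  canonical-≢F (_ , rank0 _)         ()
  canonical-≢F (_ , rank1 _ _ _ _)   ()
  canonical-≢F (_ , rank2 _ _ _ _ _) ()

  canonical-≢G : ∀ {φ ψ} → IsCanonical φ → φ ≢ G ψ
  canonical-≢G (_ , rank0 _)         ()
  canonical-≢G (_ , rank1 _ _ _ _)   ()
  canonical-≢G (_ , rank2 _ _ _ _ _) ()

  canonical-≢⌜⌝ : ∀ {φ} q → IsCanonical φ → φ ≢ ⌜ q ⌝
  canonical-≢⌜⌝ q (_ , rank0 _)          eq = ⌜⌝≢canon q [] (sym eq)
  canonical-≢⌜⌝ q (_ , rank1 _ ψ ψs _)   eq = ⌜⌝≢canon q (ψ ∷ ψs) (sym eq)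
  canonical-≢⌜⌝ q (_ , rank2 _ ψs _ _ _) eq = ⌜⌝≢canon q ψs (sym eq)

  Covered-∷ʳ : ∀ {φ} w {i} → Covered φ w → Covered φ (w ∷ʳ i)
  Covered-∷ʳ w {i} (u , u′ , refl , m) = u , u′ ∷ʳ i , ++-assoc u u′ (i ∷ []) , m

  module _ {φ σ τ ρ} .{{_ : NonZero (length ρ)}} (lasso : IsLasso σ τ ρ)
           (models : σ , τ ++∞ ρ ^ω ⊨ φ) where
    open Lasso σ τ ρ lasso
    open Unfolding σ (τ ++∞ ρ ^ω) (length τ)

    can-holds : Holds 0 (can φ)
    can-holds = Holds-can C applicable φ (⊨⇒Holds φ refl (λ _ → refl) models)

    -- The root ⟨can(φ),0⟩ becomes child 0 of a virtual node with the empty word.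
    origin : Node
    origin = mkNode false 0 (F (can φ)) (λ ()) (0 , z≤n , can-holds)

    nodeAt : Word → Node
    nodeAt = descendant origin

    nodeAt-∷ʳ : ∀ w i → nodeAt (w ∷ʳ i) ≡ child (nodeAt w) i
    nodeAt-∷ʳ w i = foldl-∷ʳ child origin i w

    -- Induction on tree membership. `Unfolds` compares formulas only, so each constructor must
    -- refute the alternatives that do not fit its shape. A G-node is covered by its own word, with
    -- empty remainder.
    nodeAt-faithful : ∀ {ψ ψ′ w} → 𝒯 φ ψ w → Unfolds φ ψ ψ′ →
      body (nodeAt w) ≡ ψ′ × (covered (nodeAt w) ≡ true → Covered φ w)
    nodeAt-faithful root (inj₁ (refl , _)) = refl , λ ()
    nodeAt-faithful root (inj₂ (inj₁ eq)) = contradiction eq (canonical-≢F (canonical φ))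
    nodeAt-faithful root (inj₂ (inj₂ eq)) = contradiction eq (canonical-≢G (canonical φ))
    nodeAt-faithful (prop-node p _ _ _ _ _) (inj₁ (refl , eq)) =
      contradiction (sym eq) (canonical-≢⌜⌝ p (canonical φ))
    nodeAt-faithful (prop-node p _ _ _ _ _) (inj₂ (inj₁ eq)) = contradiction eq (⌜⌝≢F p)
    nodeAt-faithful (prop-node p _ _ _ _ _) (inj₂ (inj₂ eq)) = contradiction eq (⌜⌝≢G p)
    nodeAt-faithful (F-node _ _ _ _ _ _ _) (inj₁ (refl , eq)) =
      contradiction (sym eq) (canonical-≢F (canonical φ))
    nodeAt-faithful (F-node {w = w} p ψs χ m u _ i) (inj₂ (inj₁ refl))
      rewrite nodeAt-∷ʳ w (suc (toℕ i)) =
      let body≡ , cov = nodeAt-faithful m u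
          child≡ , cov≡ = child-F ψs (nodeAt w) body≡ i
      in child≡ , λ eq → Covered-∷ʳ w (cov (trans (sym cov≡) eq))
    nodeAt-faithful (G-node _ _ _ _ _ _) (inj₁ (refl , eq)) =
      contradiction (sym eq) (canonical-≢G (canonical φ))
    nodeAt-faithful g@(G-node {w = w} p ψs χ m u _) (inj₂ (inj₂ refl))
      rewrite nodeAt-∷ʳ w (suc (length ψs)) =
      proj₁ (child-G ψs (nodeAt w) (proj₁ (nodeAt-faithful m u))) ,
      λ _ → w ∷ʳ suc (length ψs) , [] , sym (++-identityʳ _) , (_ , g)

    F-body : ∀ {ψ w} → 𝒯 φ (F ψ) w → body (nodeAt w) ≡ ψ
    F-body m = proj₁ (nodeAt-faithful m (inj₂ (inj₁ refl)))

    covered-G : ∀ {ψ χ w} → 𝒯 φ ψ w → ψ ≡ G χ → covered (nodeAt w) ≡ true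
    covered-G root eq = contradiction eq (canonical-≢G (canonical φ))
    covered-G (prop-node p _ _ _ _ _) eq = contradiction eq (⌜⌝≢G p)
    covered-G (F-node _ _ _ _ _ _ _) ()
    covered-G (G-node {w = w} p ψs χ m u _) _
      rewrite nodeAt-∷ʳ w (suc (length ψs)) =
      proj₂ (child-G ψs (nodeAt w) (proj₁ (nodeAt-faithful m u)))

    covered-F : ∀ {ψ w} → 𝒯 φ (F ψ) w → Covered φ w → covered (nodeAt w) ≡ true
    covered-F _ (u , u′ , refl , _ , g)
      rewrite foldl-++ child origin u u′ =
      descendant-covered u′ (nodeAt u) (covered-G g refl)

    uncovered-F : ∀ {ψ w} → 𝒯 φ (F ψ) w → ¬ Covered φ w → covered (nodeAt w) ≡ false
    uncovered-F {w = w} m ¬cov with covered (nodeAt w) | proj₂ (nodeAt-faithful m (inj₂ (inj₁ refl)))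
    ... | true  | cov = contradiction (cov refl) ¬cov
    ... | false | _   = refl

    -- Number of loop copies and positions in the unrolled lasso.

    bounded : ∃[ B ] ∀ w → Bounded B (nodeAt w)
    bounded = bound-descendants (F (can φ)) false 0 (λ ()) (0 , z≤n , can-holds)

    -- The bound on uncovered positions doubles as the number of copies, because each copy of the
    -- nonempty `ρ` has length at least one.
    K : ℕ
    K = proj₁ bounded

    τ′ : Schedule
    τ′ = τ ++ ρ ^ K

    K≤τ′ : K ≤ length τ′
    K≤τ′ = ≤-trans (k≤length-^ ρ K)
      (≤-trans (m≤n+m _ (length τ)) (≤-reflexive (sym (length-++ τ))))

    0<ρ : 0 < length ρ
    0<ρ = >-nonZero⁻¹ (length ρ)

    index : Node → ℕ
    index v with covered v
    ... | true  = length τ′ + (pos v ∸ length τ) % length ρ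
    ... | false = pos v

    index-covered-≥ : ∀ v → covered v ≡ true → length τ′ ≤ index v
    index-covered-≥ v cov rewrite cov = m≤m+n _ _

    index-covered-≤ : ∀ v → covered v ≡ true → index v ≤ length τ′ + length ρ ∸ 1
    index-covered-≤ v cov rewrite cov =
      ≤-trans (+-monoʳ-≤ (length τ′) (<⇒≤pred (m%n<n (pos v ∸ length τ) (length ρ))))
        (≤-reflexive (sym (+-∸-assoc (length τ′) 0<ρ)))

    index-uncovered : ∀ v → covered v ≡ false → index v ≡ pos v
    index-uncovered v unc rewrite unc = refl

    index-uncovered-≤ : ∀ w → covered (nodeAt w) ≡ false → index (nodeAt w) ≤ length τ′
    index-uncovered-≤ w unc = subst (_≤ length τ′) (sym (index-uncovered (nodeAt w) unc))
      (≤-trans (proj₂ bounded w unc) K≤τ′)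

    index-< : ∀ w → index (nodeAt w) < length τ′ + length ρ
    index-< w with covered (nodeAt w) in eq
    ... | true  = +-monoʳ-< (length τ′) (m%n<n _ (length ρ))
    ... | false = ≤-<-trans (≤-trans (proj₂ bounded w eq) K≤τ′) (m<m+n (length τ′) 0<ρ)

    -- Moving a covered node by whole rounds of the loop does not change its configuration; `late`
    -- makes the truncated subtraction exact.
    at-index : ∀ v → at (index v) ≡ at (pos v)
    at-index v with covered v in eq
    ... | false = refl
    ... | true  = begin
      at (length τ′ + j % length ρ)  ≡⟨ at-unrolled K (j % length ρ) ⟩
      loop (j % length ρ)            ≡⟨ loop-% j ⟩
      loop j                         ≡⟨ at-loop j ⟨
      at (length τ + j)              ≡⟨ cong at (m+[n∸m]≡n (late v eq)) ⟩
      at (pos v)                     ∎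
      where
      open ≡-Reasoning
      j = pos v ∸ length τ

    index<τ′⇒≡pos : ∀ v → index v < length τ′ → index v ≡ pos v
    index<τ′⇒≡pos v lt with covered v
    ... | true  = contradiction lt (≤⇒≯ (m≤m+n _ _))
    ... | false = refl

    -- The cut graph and the cut function.

    ι : Vertex φ → ℕ
    ι loopStart  = length τ′
    ι loopEnd    = length τ′ + length ρ ∸ 1
    ι (node w _) = index (nodeAt w)

    ι-< : ∀ v → ι v < length τ′ + length ρ
    ι-< loopStart  = m<m+n (length τ′) 0<ρ
    ι-< loopEnd    = ∸-monoʳ-< (s≤s z≤n) (≤-trans 0<ρ (m≤n+m _ (length τ′)))
    ι-< (node w _) = index-< w

    class : Word → ℕ
    class w = if covered (nodeAt w) then 2 else 0

    -- Vertices at the same position are ordered as uncovered nodes, loopStart,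
    -- covered nodes, loopEnd; within one class, by their words.
    tieBreak : Vertex φ → List ℕ
    tieBreak loopStart  = 1 ∷ []
    tieBreak loopEnd    = 3 ∷ []
    tieBreak (node w _) = class w ∷ w

    -- All pairs increasing in the key (position, class, word) are edges. A cycle then collapses by
    -- transitivity to a key below itself.
    E : Rel (Vertex φ) 0ℓ
    E u v = ι u ∷ tieBreak u ≺ ι v ∷ tieBreak v

    E⁺⇒E : ∀ {u v} → TransClosure E u v → E u v
    E⁺⇒E [ e ]    = e
    E⁺⇒E (e ∷ es) = ≺-trans e (E⁺⇒E es)

    cutGraph : CutGraph φ
    cutGraph = record
      { E       = E
      ; acyclic = λ v cycle → ≺-irrefl (E⁺⇒E cycle)
      ; edge-a  = λ {_} {w} m ¬cov → edge-a w (uncovered-F m ¬cov)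
      ; edge-b  = λ {_} {w} m cov → edge-b w (covered-F m cov)
      ; edge-c  = λ {_} {_} {w} {i} m m′ ¬cov ¬cov′ →
                    edge-c w i (uncovered-F m ¬cov) (uncovered-F m′ ¬cov′)
      ; edge-d  = λ m₁ m₂ distinct _ _ → edge-d m₁ m₂ distinct
      }
      where
      edge-a : ∀ w → covered (nodeAt w) ≡ false →
               index (nodeAt w) ∷ class w ∷ w ≺ length τ′ ∷ 1 ∷ []
      edge-a w unc = ∷-mono-≺ (index-uncovered-≤ w unc)
        (this (subst (λ c → (if c then 2 else 0) < 1) (sym unc) (s≤s z≤n)))

      edge-b : ∀ w → covered (nodeAt w) ≡ true →
               length τ′ ∷ 1 ∷ [] ≺ index (nodeAt w) ∷ class w ∷ w ×
               index (nodeAt w) ∷ class w ∷ w ≺ length τ′ + length ρ ∸ 1 ∷ 3 ∷ []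
      edge-b w cov =
        ∷-mono-≺ (index-covered-≥ (nodeAt w) cov)
          (this (subst (λ c → 1 < (if c then 2 else 0)) (sym cov) ≤-refl)) ,
        ∷-mono-≺ (index-covered-≤ (nodeAt w) cov)
          (this (subst (λ c → (if c then 2 else 0) < 3) (sym cov) ≤-refl))

      edge-c : ∀ w i → covered (nodeAt w) ≡ false → covered (nodeAt (w ∷ʳ i)) ≡ false →
               index (nodeAt w) ∷ class w ∷ w ≺
               index (nodeAt (w ∷ʳ i)) ∷ class (w ∷ʳ i) ∷ (w ∷ʳ i)
      edge-c w i unc unc′ = ∷-mono-≺
        (subst₂ _≤_ (sym (index-uncovered (nodeAt w) unc)) (sym (index-uncovered (nodeAt (w ∷ʳ i)) unc′))
          (subst (λ v → pos (nodeAt w) ≤ pos v) (sym (nodeAt-∷ʳ w i)) (proj₁ (child-⊑ (nodeAt w) i))))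
        -- Both words have the same class, and a proper prefix precedes its extension.
        (next (cong (λ c → if c then 2 else 0) (trans unc (sym unc′))) (xs≺xs∷ʳx w))

      edge-d : ∀ {ψ₁ ψ₂ w₁ w₂} (m₁ : 𝒯 φ (F ψ₁) w₁) (m₂ : 𝒯 φ (F ψ₂) w₂) →
               (F ψ₁ , w₁) ≢ (F ψ₂ , w₂) →
               let v₁ = node w₁ (ψ₁ , m₁)
                   v₂ = node w₂ (ψ₂ , m₂)
               in (E v₁ v₂ × ¬ E v₂ v₁) ⊎ (E v₂ v₁ × ¬ E v₁ v₂)
      edge-d {w₁ = w₁} {w₂} m₁ m₂ distinct with ≺-connex keys-differ
        where
        keys-differ : index (nodeAt w₁) ∷ class w₁ ∷ w₁ ≢ index (nodeAt w₂) ∷ class w₂ ∷ w₂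
        -- Equal keys contain equal words, and the word determines the F-formula through the body of
        -- its node.
        keys-differ eq with refl ← proj₂ (∷-injective (proj₂ (∷-injective eq))) =
          distinct (cong (λ ψ → F ψ , w₁) (trans (sym (F-body m₁)) (F-body m₂)))
      ... | inj₁ e = inj₁ (e , ≺-asym e)
      ... | inj₂ e = inj₂ (e , ≺-asym e)

    cutFunction : CutFunction cutGraph τ′ ρ
    cutFunction = record
      { ζ        = λ v → fromℕ< (ι-< v)
      ; ζ-start  = toℕ-fromℕ< (ι-< loopStart)
      ; ζ-end    = toℕ-fromℕ< (ι-< loopEnd)
      ; monotone = λ {u} {v} e →
          subst₂ _≤_ (sym (toℕ-fromℕ< (ι-< u))) (sym (toℕ-fromℕ< (ι-< v))) (∷-cancel-≺ e)
      }

    -- The witness conditions.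

    module _ {ψ₀} ψs {χ w} (m : 𝒯 φ (F (canon ψ₀ ψs χ)) w) where

      F-holds : Holds (pos (nodeAt w)) (canon ψ₀ ψs χ)
      F-holds = subst (Holds _) (F-body m) (holds (nodeAt w))

      cut-prop : ∀ π′ π″ → Cuts (index (nodeAt w)) (τ′ ++ ρ) π′ π″ → run π′ σ ⊨ᴾ ψ₀
      cut-prop π′ π″ (eq , len) = subst (_⊨ᴾ ψ₀) (sym same) (Holds-⌜⌝ ψ₀ (proj₁ F-holds))
        where
        same : run π′ σ ≡ at (pos (nodeAt w))
        same = trans (at-prefix K π′ π″ eq) (trans (cong at len) (at-index (nodeAt w)))

    isWitness : IsWitness σ τ′ ρ cutFunction
    isWitness = record
      { C1 = C1
      ; C2 = λ _ ψs χ {w} m → C2 ψs χ m (toℕ-fromℕ< (index-< w))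
      ; C3 = λ _ ψs χ {w} m → C3 ψs χ m (toℕ-fromℕ< (index-< w))
      }
      where
      C1 : ∀ ψ₀ ψs χ → can φ ≡ canon ψ₀ ψs χ → σ ⊨ᴾ ψ₀ × Cfgs σ (τ′ ++ ρ) (prop χ)
      C1 ψ₀ ψs χ eq with h , h′ ← subst (Holds 0) eq can-holds =
        Holds-⌜⌝ ψ₀ h , G⇒Cfgs-from C K χ (Holds-canon-G ψs h′) [] (τ′ ++ ρ) refl z≤n

      C2 : ∀ {ψ₀} ψs χ {w k} → 𝒯 φ (F (canon ψ₀ ψs χ)) w → k ≡ index (nodeAt w) →
           k < length τ′ → ∀ π′ π″ → Cuts k (τ′ ++ ρ) π′ π″ →
           run π′ σ ⊨ᴾ ψ₀ × Cfgs (run π′ σ) π″ (prop χ)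
      C2 ψs χ {w} m refl lt π′ π″ cut@(eq , len) =
        cut-prop ψs m π′ π″ cut ,
        G⇒Cfgs-from C K χ (Holds-canon-G ψs (proj₂ (F-holds ψs m))) π′ π″ eq
          -- A cut before the loop belongs to an uncovered node, so it is the chosen position itself
          -- and the G-part holds from there on.
          (≤-reflexive (sym (trans len (index<τ′⇒≡pos (nodeAt w) lt))))

      C3 : ∀ {ψ₀} ψs χ {w k} → 𝒯 φ (F (canon ψ₀ ψs χ)) w → k ≡ index (nodeAt w) →
           k ≥ length τ′ → ∀ π′ π″ → Cuts k (τ′ ++ ρ) π′ π″ →
           run π′ σ ⊨ᴾ ψ₀ × Cfgs (run τ′ σ) ρ (prop χ)
      C3 ψs χ m refl _ π′ π″ cut =
        -- The cut may differ from the chosen position by whole rounds, but the G-part holds from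
        -- that position on and the entire loop recurs later.
        cut-prop ψs m π′ π″ cut , G⇒Cfgs-loop C K χ (Holds-canon-G ψs (proj₂ (F-holds ψs m)))

theorem4p13 : (CS : CounterSystem) (C : Semantics.Canonisation CS) →
    let open Semantics CS
        open Witnesses CS C
    in (φ : Formula) (σ : Config) (τ ρ : Schedule) .{{_ : NonZero (length ρ)}} →
    IsLasso σ τ ρ →
    σ , τ ++∞ ρ ^ω ⊨ φ →
    Σ ℕ λ K → HasWitness φ σ (τ ++ ρ ^ K) ρ
theorem4p13 CS C φ σ τ ρ lasso models =
  K lasso models , cutGraph lasso models , cutFunction lasso models , isWitness lasso models
  where open Witness CS C
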